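{- Let $\mathcal{C}$ be a complete category and $(F,G)$ a constructor specification on $\mathcal{C}$. Then the category of algebras $\mathrm{Alg}_{\mathcal{C}}(F,G)$ is complete.
   Context: Work in Martin-Löf type theory with function extensionality; $\mathsf{Set}$ is the universe/category of sets (types satisfying UIP). For $F : \mathcal{C} \Rightarrow \mathsf{Set}$, the category of elements $\int_{\mathcal{C}} F$ has objects $(X,x)$ with $x : F X$ and morphisms $f : X \to Y$ with $F(f)\,x = y$, with forgetful functor to $\mathcal{C}$. Relative continuity: for $U : \mathcal{D} \Rightarrow \mathcal{D}_0$ with $\mathcal{D}_0$ complete, a cone over a small diagram in $\mathcal{D}$ is a $U$-limit cone if $U$ maps it to a limit cone; a functor $\mathcal{D} \Rightarrow \mathsf{Set}$ is continuous relative to $U$ if it maps $U$-limit cones to limit cones in $\mathsf{Set}$. A constructor specification on a complete category $\mathcal{C}$ is a pair $(F,G)$ with $F : \mathcal{C} \Rightarrow \mathsf{Set}$ any functor and $G : \int_{\mathcal{C}} F \Rightarrow \mathsf{Set}$ continuous relative to the forgetful functor $\int_{\mathcal{C}} F \Rightarrow \mathcal{C}$. The category $\mathrm{Alg}_{\mathcal{C}}(F,G)$ has objects pairs $(X,\theta)$ with $X$ an object of $\mathcal{C}$ and $\theta : (x : F X) \to G(X,x)$ a dependent function; morphisms $(X,\theta) \to (Y,\psi)$ are morphisms $f : X \to Y$ in $\mathcal{C}$ such that for all $x : F X$, $\psi(F(f)\,x) = G(\overline{f})(\theta\,x)$, where $\overline{f} : (X,x) \to (Y, F(f)\,x)$ is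 the morphism of $\int_{\mathcal{C}} F$ determined by $f$. -}

-- Axiom K is in force, so every type in `Set ℓ` satisfies UIP: the universe
-- `Set ℓ` is itself the universe of sets, and every hom-type is a set.
module Defs where

open import Axiom.Extensionality.Propositional using (Extensionality)
open import Axiom.UniquenessOfIdentityProofs.WithK using (uip)
open import Level using (Level; _⊔_) renaming (suc to lsuc)
open import Relation.Binary.PropositionalEquality using (_≡_; refl; sym; trans; cong; cong-app)

record Category (o h : Level) : Set (lsuc (o ⊔ h)) where
  infixr 9 _∘_
  field
    Obj       : Set o
    Hom       : Obj → Obj → Set h
    id        : ∀ {X} → Hom X X
    _∘_       : ∀ {X Y Z} → Hom Y Z → Hom X Y → Hom X Z
    identityˡ : ∀ {X Y} (f : Hom X Y) → id ∘ f ≡ f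
    identityʳ : ∀ {X Y} (f : Hom X Y) → f ∘ id ≡ f
    assoc     : ∀ {W X Y Z} (f : Hom Y Z) (g : Hom X Y) (k : Hom W X) →
                (f ∘ g) ∘ k ≡ f ∘ (g ∘ k)

record Functor {o h o′ h′ : Level} (C : Category o h) (D : Category o′ h′) :
               Set (o ⊔ h ⊔ o′ ⊔ h′) where
  private
    module C = Category C
    module D = Category D
  field
    F₀           : C.Obj → D.Obj
    F₁           : ∀ {X Y} → C.Hom X Y → D.Hom (F₀ X) (F₀ Y)
    identity     : ∀ {X} → F₁ (C.id {X}) ≡ D.id
    homomorphism : ∀ {X Y Z} (g : C.Hom Y Z) (f : C.Hom X Y) →
                   F₁ (g C.∘ f) ≡ F₁ g D.∘ F₁ f

infixr 9 _∘F_

_∘F_ : ∀ {o h o′ h′ o″ h″}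
       {C : Category o h} {D : Category o′ h′} {E : Category o″ h″} →
       Functor D E → Functor C D → Functor C E
G ∘F F = record
  { F₀           = λ X → G.F₀ (F.F₀ X)
  ; F₁           = λ f → G.F₁ (F.F₁ f)
  ; identity     = trans (cong G.F₁ F.identity) G.identity
  ; homomorphism = λ g f → trans (cong G.F₁ (F.homomorphism g f))
                                 (G.homomorphism (F.F₁ g) (F.F₁ f))
  }
  where
    module F = Functor F
    module G = Functor G

Sets : (ℓ : Level) → Category (lsuc ℓ) ℓ
Sets ℓ = record
  { Obj       = Set ℓ
  ; Hom       = λ A B → A → B
  ; id        = λ a → a
  ; _∘_       = λ g f a → g (f a)
  ; identityˡ = λ _ → refl
  ; identityʳ = λ _ → refl
  ; assoc     = λ _ _ _ → refl
  }

module _ {i j o h : Level} {J : Category i j} {C : Category o h} where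
  private
    module J = Category J
    module C = Category C

  record Cone (D : Functor J C) : Set (i ⊔ j ⊔ o ⊔ h) where
    private
      module D = Functor D
    field
      apex    : C.Obj
      leg     : ∀ a → C.Hom apex (D.F₀ a)
      commute : ∀ {a b} (u : J.Hom a b) → D.F₁ u C.∘ leg a ≡ leg b

  record IsLimit {D : Functor J C} (L : Cone D) : Set (i ⊔ j ⊔ o ⊔ h) where
    private
      module L = Cone L
    field
      mediate  : (K : Cone D) → C.Hom (Cone.apex K) L.apex
      factors  : (K : Cone D) → ∀ a → L.leg a C.∘ mediate K ≡ Cone.leg K a
      unique   : (K : Cone D) (m : C.Hom (Cone.apex K) L.apex) →
                 (∀ a → L.leg a C.∘ m ≡ Cone.leg K a) → m ≡ mediate K

  record Limit (D : Functor J C) : Set (i ⊔ j ⊔ o ⊔ h) where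
    field
      cone    : Cone D
      isLimit : IsLimit cone

mapCone : ∀ {i j o h o′ h′}
          {J : Category i j} {C : Category o h} {E : Category o′ h′}
          (U : Functor C E) {D : Functor J C} → Cone D → Cone (U ∘F D)
mapCone U {D} K = record
  { apex    = U.F₀ K.apex
  ; leg     = λ a → U.F₁ (K.leg a)
  ; commute = λ {a} u → trans (sym (U.homomorphism (Functor.F₁ D u) (K.leg a)))
                              (cong U.F₁ (K.commute u))
  }
  where
    module U = Functor U
    module K = Cone K

-- "Small" means that objects and morphisms lie in `Set ℓ`.
Complete : (ℓ : Level) {o h : Level} → Category o h → Set (lsuc ℓ ⊔ o ⊔ h)
Complete ℓ C = (J : Category ℓ ℓ) (D : Functor J C) → Limit D

module _ {o h o₀ h₀ : Level} {D : Category o h} {D₀ : Category o₀ h₀} where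

  IsRelativeLimit : ∀ {i j} {J : Category i j} (U : Functor D D₀)
                    {T : Functor J D} → Cone T → Set (i ⊔ j ⊔ o₀ ⊔ h₀)
  IsRelativeLimit U K = IsLimit (mapCone U K)

  RelativelyContinuous : {ℓ : Level} → Functor D D₀ → Functor D (Sets ℓ) →
                         Set (lsuc ℓ ⊔ o ⊔ h ⊔ o₀ ⊔ h₀)
  RelativelyContinuous {ℓ} U G =
    (J : Category ℓ ℓ) (T : Functor J D) (K : Cone T) →
    IsRelativeLimit U K → IsLimit (mapCone G K)

module Elements {o h ℓ : Level} {C : Category o h} (F : Functor C (Sets ℓ)) where
  private
    module C = Category C
    module F = Functor F

  record Element : Set (o ⊔ ℓ) where
    constructor _,_
    field
      obj : C.Obj
      elt : F.F₀ obj

  record ElementHom (A B : Element) : Set (h ⊔ ℓ) where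
    constructor _,_
    private
      module A = Element A
      module B = Element B
    field
      arr       : C.Hom A.obj B.obj
      preserves : F.F₁ arr A.elt ≡ B.elt

  open ElementHom

  ElementHom-≡ : ∀ {A B} {f g : ElementHom A B} → arr f ≡ arr g → f ≡ g
  ElementHom-≡ {f = f , p} {g = .f , q} refl = cong (f ,_) (uip p q)

  ∫ : Category (o ⊔ ℓ) (h ⊔ ℓ)
  ∫ = record
    { Obj       = Element
    ; Hom       = ElementHom
    ; id        = λ {A} → C.id , cong-app F.identity (Element.elt A)
    ; _∘_       = λ {A} g f → (arr g C.∘ arr f) ,
                    trans (cong-app (F.homomorphism (arr g) (arr f)) (Element.elt A))
                          (trans (cong (F.F₁ (arr g)) (preserves f)) (preserves g))
    ; identityˡ = λ f → ElementHom-≡ (C.identityˡ (arr f))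
    ; identityʳ = λ f → ElementHom-≡ (C.identityʳ (arr f))
    ; assoc     = λ f g k → ElementHom-≡ (C.assoc (arr f) (arr g) (arr k))
    }

  forget : Functor ∫ C
  forget = record
    { F₀           = Element.obj
    ; F₁           = arr
    ; identity     = refl
    ; homomorphism = λ _ _ → refl
    }

  lift : ∀ {X Y} (f : C.Hom X Y) (x : F.F₀ X) → ElementHom (X , x) (Y , F.F₁ f x)
  lift f x = f , refl

record ConstructorSpec (ℓ : Level) {o h : Level} (C : Category o h) :
                       Set (lsuc ℓ ⊔ o ⊔ h) where
  field
    F          : Functor C (Sets ℓ)
    G          : Functor (Elements.∫ F) (Sets ℓ)
    continuous : RelativelyContinuous (Elements.forget F) G

module Algebras {o h ℓ : Level} {C : Category o h} (S : ConstructorSpec ℓ C) where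
  open ConstructorSpec S using (F; G)
  open Elements F
  private
    module C = Category C
    module F = Functor F
    module G = Functor G

  record Algebra : Set (o ⊔ ℓ) where
    constructor _,_
    field
      carrier : C.Obj
      θ       : (x : F.F₀ carrier) → G.F₀ (carrier , x)

  IsAlgebraHom : (A B : Algebra) → C.Hom (Algebra.carrier A) (Algebra.carrier B) → Set ℓ
  IsAlgebraHom (X , θ) (Y , ψ) f =
    (x : F.F₀ X) → ψ (F.F₁ f x) ≡ G.F₁ (lift f x) (θ x)

  record AlgebraHom (A B : Algebra) : Set (h ⊔ ℓ) where
    constructor _,_
    field
      arr   : C.Hom (Algebra.carrier A) (Algebra.carrier B)
      isHom : IsAlgebraHom A B arr

  -- The homomorphism equation along an arbitrary morphism of ∫ F over f,
  -- not just the canonical lift.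
  isHom-over : ∀ {A B} (f : AlgebraHom A B) (let open Algebra) →
               ∀ {x y} (p : F.F₁ (AlgebraHom.arr f) x ≡ y) →
               θ B y ≡ G.F₁ (AlgebraHom.arr f , p) (θ A x)
  isHom-over f {x} refl = AlgebraHom.isHom f x

  idHom : ∀ {A} → AlgebraHom A A
  idHom {X , θ} = C.id , λ x → over (cong-app F.identity x) refl
    where
      over : ∀ {x y} → y ≡ x → (p : F.F₁ C.id x ≡ y) → θ y ≡ G.F₁ (C.id , p) (θ x)
      over {x} refl p = sym (trans (cong (λ e → G.F₁ e (θ x)) (ElementHom-≡ refl))
                                   (cong-app G.identity (θ x)))

  compHom : ∀ {A B D} → AlgebraHom B D → AlgebraHom A B → AlgebraHom A D
  compHom {X , θ} {Y , ψ} {Z , χ} gh@(g , _) fh@(f , _) = (g C.∘ f) , λ x →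
    let q  = sym (cong-app (F.homomorphism g f) x)
        g′ = g , q
    in trans (isHom-over gh q)
      (trans (cong (G.F₁ g′) (isHom-over fh refl))
      (trans (sym (cong-app (G.homomorphism g′ (lift f x)) (θ x)))
             (cong (λ e → G.F₁ e (θ x)) (ElementHom-≡ refl))))

  module _ (ext : Extensionality ℓ ℓ) where

    AlgebraHom-≡ : ∀ {A B} {f g : AlgebraHom A B} →
                   AlgebraHom.arr f ≡ AlgebraHom.arr g → f ≡ g
    AlgebraHom-≡ {f = f , p} {g = .f , q} refl = cong (f ,_) (ext λ x → uip (p x) (q x))

    Alg : Category (o ⊔ ℓ) (h ⊔ ℓ)
    Alg = record
      { Obj       = Algebra
      ; Hom       = AlgebraHom
      ; id        = idHom
      ; _∘_       = compHom
      ; identityˡ = λ f → AlgebraHom-≡ (C.identityˡ (AlgebraHom.arr f))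
      ; identityʳ = λ f → AlgebraHom-≡ (C.identityʳ (AlgebraHom.arr f))
      ; assoc     = λ f g k → AlgebraHom-≡ (C.assoc (AlgebraHom.arr f)
                                                    (AlgebraHom.arr g)
                                                    (AlgebraHom.arr k))
      }

open Algebras public using (Alg)

{-# OPTIONS --safe #-}
-- The limit is created by the forgetful functor to C.  Let L be the limit in C
-- of the carriers.  A point x : F L makes the limiting cone of L into a cone in
-- ∫ F with apex (L , x), which is a limit cone relative to the forgetful functor.
-- By continuity G (L , x) is then the limit of the sets G (Dₐ , F (legₐ) x), and
-- the elements θₐ (F (legₐ) x) form a compatible family, i.e. a unique point θ x.
-- Since points of G (L , x) are determined by their projections, mediating
-- morphisms in C are automatically algebra morphisms.
module Submission where

open import Defs
open import Axiom.Extensionality.Propositional using (Extensionality)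
open import Data.Unit.Polymorphic.Base using (⊤; tt)
open import Level using (Level)
open import Relation.Binary.PropositionalEquality using (_≡_; refl; sym; trans; cong; cong-app)

module _ {i j ℓ : Level} {J : Category i j} {D : Functor J (Sets ℓ)} where
  private
    module J = Category J
    module D = Functor D

  -- Maps out of `⊤` are points, so the universal property against cones of this kind describes the
  -- elements of a limit set.
  pointCone : (p : ∀ a → D.F₀ a) → (∀ {a b} (u : J.Hom a b) → D.F₁ u (p a) ≡ p b) → Cone D
  pointCone p compatible = record
    { apex    = ⊤
    ; leg     = λ a _ → p a
    ; commute = λ u → cong (λ y _ → y) (compatible u)
    }

  module _ {K : Cone D} (isLimit : IsLimit K) where
    private
      module K = Cone K
      open IsLimit isLimit

    limitPoint : (p : ∀ a → D.F₀ a) → (∀ {a b} (u : J.Hom a b) → D.F₁ u (p a) ≡ p b) → K.apex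
    limitPoint p compatible = mediate (pointCone p compatible) tt

    leg-limitPoint : (p : ∀ a → D.F₀ a)
                     (compatible : ∀ {a b} (u : J.Hom a b) → D.F₁ u (p a) ≡ p b) →
                     ∀ a → K.leg a (limitPoint p compatible) ≡ p a
    leg-limitPoint p compatible a = cong-app (factors (pointCone p compatible) a) tt

    -- The constant maps at `y` and at `z` both factor the cone of projections of `z`, so uniqueness
    -- identifies them.
    legs-jointly-injective : {y z : K.apex} → (∀ a → K.leg a y ≡ K.leg a z) → y ≡ z
    legs-jointly-injective {y} {z} same =
      trans (cong-app (unique Z (λ _ → y) λ a → cong (λ w _ → w) (same a)) tt)
            (sym (cong-app (unique Z (λ _ → z) λ _ → refl) tt))
      where
        Z : Cone D
        Z = pointCone (λ a → K.leg a z) (λ u → cong-app (K.commute u) z)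

module _ {i j o h : Level} {J : Category i j} {C : Category o h} where
  private
    module J = Category J
    module C = Category C

  -- Functors with the same action on objects and arrows need not be
  -- definitionally equal, as their law proofs may differ; limits only depend
  -- on the actions.
  module _ {F₀ : J.Obj → C.Obj} {F₁ : ∀ {a b} → J.Hom a b → C.Hom (F₀ a) (F₀ b)}
           {id₁ id₂ : ∀ {a} → F₁ (J.id {a}) ≡ C.id}
           {hom₁ hom₂ : ∀ {a b c} (g : J.Hom b c) (f : J.Hom a b) →
                        F₁ (g J.∘ f) ≡ F₁ g C.∘ F₁ f} where
    private
      D₁ D₂ : Functor J C
      D₁ = record { F₀ = F₀ ; F₁ = F₁ ; identity = id₁ ; homomorphism = hom₁ }
      D₂ = record { F₀ = F₀ ; F₁ = F₁ ; identity = id₂ ; homomorphism = hom₂ }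

    changeLaws : Cone D₁ → Cone D₂
    changeLaws K = record { apex = apex ; leg = leg ; commute = commute }
      where open Cone K

module AlgebraLimits {o h ℓ : Level} (ext : Extensionality ℓ ℓ) {C : Category o h}
                     (S : ConstructorSpec ℓ C) where
  open ConstructorSpec S
  open Elements F hiding (_,_)
  open Algebras S hiding (_,_; Alg)
  private
    module C = Category C
    module F = Functor F
    module G = Functor G
  open Algebra
  open AlgebraHom

  carrierFunctor : Functor (Alg S ext) C
  carrierFunctor = record
    { F₀           = carrier
    ; F₁           = arr
    ; identity     = refl
    ; homomorphism = λ _ _ → refl
    }

  module _ {J : Category ℓ ℓ} (D : Functor J (Alg S ext))
           (limit : Limit (carrierFunctor ∘F D)) where
    private
      module J = Category J
      module D = Functor D
      open Limit limit renaming (cone to L; isLimit to L-isLimit)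
      module L = Cone L
      open IsLimit L-isLimit

    module _ (x : F.F₀ L.apex) where
      legs-compatible : ∀ {a b} (u : J.Hom a b) →
                        F.F₁ (arr (D.F₁ u)) (F.F₁ (L.leg a) x) ≡ F.F₁ (L.leg b) x
      legs-compatible {a} u =
        trans (sym (cong-app (F.homomorphism (arr (D.F₁ u)) (L.leg a)) x))
              (cong (λ f → F.F₁ f x) (L.commute u))

      elementDiagram : Functor J ∫
      elementDiagram = record
        { F₀           = λ a → carrier (D.F₀ a) Elements., F.F₁ (L.leg a) x
        ; F₁           = λ u → arr (D.F₁ u) Elements., legs-compatible u
        ; identity     = ElementHom-≡ (cong arr D.identity)
        ; homomorphism = λ g f → ElementHom-≡ (cong arr (D.homomorphism g f))
        }

      elementCone : Cone elementDiagram
      elementCone = record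
        { apex    = L.apex Elements., x
        ; leg     = λ a → lift (L.leg a) x
        ; commute = λ u → ElementHom-≡ (L.commute u)
        }

      -- `forget ∘F elementDiagram` and `carrierFunctor ∘F D` differ only in their law proofs, so
      -- the universal property of `L` carries over.
      elementCone-isRelativeLimit : IsRelativeLimit forget elementCone
      elementCone-isRelativeLimit = record
        { mediate = λ K → mediate (changeLaws K)
        ; factors = λ K → factors (changeLaws K)
        ; unique  = λ K → unique (changeLaws K)
        }

      G-elementCone-isLimit : IsLimit (mapCone G elementCone)
      G-elementCone-isLimit =
        continuous J elementDiagram elementCone elementCone-isRelativeLimit

      θ-leg : ∀ a → G.F₀ (carrier (D.F₀ a) Elements., F.F₁ (L.leg a) x)
      θ-leg a = θ (D.F₀ a) (F.F₁ (L.leg a) x)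

      θ-leg-compatible : ∀ {a b} (u : J.Hom a b) →
                         G.F₁ (arr (D.F₁ u) Elements., legs-compatible u) (θ-leg a) ≡ θ-leg b
      -- `legs-compatible u` is not `refl`, so the homomorphism equation is needed over a morphism
      -- of `∫` other than the canonical lift.
      θ-leg-compatible u = sym (isHom-over (D.F₁ u) (legs-compatible u))

    limitAlgebra : Algebra
    limitAlgebra = L.apex Algebras., λ x →
      limitPoint (G-elementCone-isLimit x) (θ-leg x) (θ-leg-compatible x)

    -- The projection equation that defines the structure map of `limitAlgebra` is, reversed, the
    -- homomorphism equation of the leg.
    leg-isHom : ∀ a → IsAlgebraHom limitAlgebra (D.F₀ a) (L.leg a)
    leg-isHom a x =
      sym (leg-limitPoint (G-elementCone-isLimit x) (θ-leg x) (θ-leg-compatible x) a)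

    algebraCone : Cone D
    algebraCone = record
      { apex    = limitAlgebra
      ; leg     = λ a → L.leg a Algebras., leg-isHom a
      ; commute = λ u → AlgebraHom-≡ ext (L.commute u)
      }

    module _ (K : Cone D) where
      private
        module K = Cone K
        m : C.Hom (carrier K.apex) L.apex
        m = mediate (mapCone carrierFunctor K)

      mediate-isHom : IsAlgebraHom K.apex limitAlgebra m
      mediate-isHom y = legs-jointly-injective (G-elementCone-isLimit (F.F₁ m y)) λ a →
        let leg∘m≡ = factors (mapCone carrierFunctor K) a
            -- Places `F.F₁ (L.leg a) (F.F₁ m y)` over `y` along `K.leg a`, so that the homomorphism
            -- equation of `K.leg a` applies there.
            over   = trans (cong (λ f → F.F₁ f y) (sym leg∘m≡))
                           (cong-app (F.homomorphism (L.leg a) m) y)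
        in trans (sym (leg-isHom a (F.F₁ m y)))
          (trans (isHom-over (K.leg a) over)
          -- In `∫`, the morphism over `K.leg a` equals the composite of the lifts of `L.leg a` and
          -- `m`, which `G` then splits.
          (trans (cong (λ e → G.F₁ e (θ K.apex y)) (ElementHom-≡ (sym leg∘m≡)))
                 (cong-app (G.homomorphism (lift (L.leg a) (F.F₁ m y)) (lift m y))
                           (θ K.apex y))))

    algebraLimit : Limit D
    algebraLimit = record
      { cone    = algebraCone
      ; isLimit = record
        { mediate = λ K → mediate (mapCone carrierFunctor K) Algebras., mediate-isHom K
        ; factors = λ K a → AlgebraHom-≡ ext (factors (mapCone carrierFunctor K) a)
        ; unique  = λ K m eq → AlgebraHom-≡ ext
            (unique (mapCone carrierFunctor K) (arr m) λ a → cong arr (eq a))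
        }
      }

mainTheorem7 : {o h ℓ : Level} (ext : Extensionality ℓ ℓ) (C : Category o h) → Complete ℓ C → (S : ConstructorSpec ℓ C) → Complete ℓ (Alg S ext)
mainTheorem7 ext C complete S J D = algebraLimit D (complete J (carrierFunctor ∘F D))
  where open AlgebraLimits ext S
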